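{- For all natural numbers $n\geq 1$, \[a_3(n)=3p(n)-p(n+1)-2p(n+2)+p(n+3).\]
   Context: $p(n)$ denotes the number of partitions of $n$. $a_3(n)$ denotes the number of partitions of $n$ in which the smallest part occurs at least $3$ times. -}

module Defs where

open import Data.Empty using (⊥)
open import Data.List.Base using (List; []; _∷_; _++_; map; filter; length)
open import Data.List.Membership.Propositional using (_∈_)
open import Data.List.Membership.Propositional.Properties
  using (∈-map⁺; ∈-map⁻; ∈-++⁺ˡ; ∈-++⁺ʳ; ∈-filter⁺; ∈-filter⁻)
open import Data.List.Properties using (∷-injectiveʳ)
open import Data.List.Relation.Unary.All as All using (All; []; _∷_)
import Data.List.Relation.Unary.All.Properties as All using (++⁺; map⁺)
open import Data.List.Relation.Unary.AllPairs using ([]; _∷_)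
open import Data.List.Relation.Unary.Any as Any using (Any; here)
open import Data.List.Relation.Unary.Linked using (Linked; linked?)
open import Data.List.Relation.Unary.Unique.Propositional using (Unique)
import Data.List.Relation.Unary.Unique.Propositional.Properties as Unique
open import Data.Nat.Base using (ℕ; zero; suc; _+_; _≤_; _≥_; _<_; s≤s; z≤n)
open import Data.Nat.ListAction using (sum)
open import Data.Nat.Properties using (_≤?_; _≥?_; _≟_; suc-injective)
open import Data.Product.Base using (_×_; _,_)
open import Relation.Binary.PropositionalEquality using (_≡_; refl; cong)
open import Relation.Nullary.Decidable using (_×-dec_)
open import Relation.Unary using (Decidable)

record IsComposition (n : ℕ) (parts : List ℕ) : Set where
  constructor isComposition
  field
    positive : All (0 <_) parts
    total    : sum parts ≡ n

-- A partition of n is represented by listing its parts in weakly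
-- decreasing order, so that each partition is exactly one list.
record IsPartition (n : ℕ) (parts : List ℕ) : Set where
  constructor isPartition
  field
    positive   : All (0 <_) parts
    decreasing : Linked _≥_ parts
    total      : sum parts ≡ n

bump : List ℕ → List ℕ
bump []       = []
bump (x ∷ xs) = suc x ∷ xs

-- A composition of n + 2 either starts with 1, or arises from a composition
-- of n + 1 by increasing its first part.
compositions : ℕ → List (List ℕ)
compositions 0             = [] ∷ []
compositions 1             = (1 ∷ []) ∷ []
compositions (suc (suc n)) =
  map (1 ∷_) (compositions (suc n)) ++ map bump (compositions (suc n))

-- The lemmas partitions-sound, partitions-complete and partitions-unique
-- below show that this lists every partition of n exactly once.
partitions : ℕ → List (List ℕ)
partitions n = filter (linked? _≥?_) (compositions n)

p : ℕ → ℕ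
p n = length (partitions n)

multiplicity : ℕ → List ℕ → ℕ
multiplicity s parts = length (filter (s ≟_) parts)

-- Some part is smallest and occurs at least k times.  The empty partition
-- has no smallest part, so it never satisfies this.
SmallestOccursAtLeast : ℕ → List ℕ → Set
SmallestOccursAtLeast k parts =
  Any (λ s → All (s ≤_) parts × k ≤ multiplicity s parts) parts

smallestOccursAtLeast? : ∀ k → Decidable (SmallestOccursAtLeast k)
smallestOccursAtLeast? k parts =
  Any.any? (λ s → All.all? (s ≤?_) parts ×-dec k ≤? multiplicity s parts) parts

a₃ : ℕ → ℕ
a₃ n = length (filter (smallestOccursAtLeast? 3) (partitions n))

cons-sound : ∀ {n xs} → IsComposition n xs → IsComposition (suc n) (1 ∷ xs)
cons-sound (isComposition pos tot) = isComposition (s≤s z≤n ∷ pos) (cong suc tot)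

bump-sound : ∀ {n xs} → IsComposition (suc n) xs → IsComposition (suc (suc n)) (bump xs)
bump-sound {xs = _ ∷ _} (isComposition (_ ∷ pos) tot) =
  isComposition (s≤s z≤n ∷ pos) (cong suc tot)

compositions-sound : ∀ n → All (IsComposition n) (compositions n)
compositions-sound 0 = isComposition [] refl ∷ []
compositions-sound 1 = isComposition (s≤s z≤n ∷ []) refl ∷ []
compositions-sound (suc (suc n)) =
  All.++⁺ (All.map⁺ (All.map cons-sound (compositions-sound (suc n))))
          (All.map⁺ (All.map bump-sound (compositions-sound (suc n))))

compositions-complete : ∀ n {xs} → IsComposition n xs → xs ∈ compositions n
compositions-complete 0 {[]} _ = here refl
compositions-complete 0 {suc _ ∷ _} (isComposition _ ())
compositions-complete _ {zero ∷ _} (isComposition (() ∷ _) _)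
compositions-complete 1 {1 ∷ []} _ = here refl
compositions-complete 1 {1 ∷ suc _ ∷ _} (isComposition _ ())
compositions-complete 1 {1 ∷ zero ∷ _} (isComposition (_ ∷ () ∷ _) _)
compositions-complete 1 {suc (suc _) ∷ _} (isComposition _ ())
compositions-complete (suc (suc n)) {1 ∷ xs} (isComposition (_ ∷ pos) tot) =
  ∈-++⁺ˡ (∈-map⁺ (1 ∷_)
    (compositions-complete (suc n) (isComposition pos (suc-injective tot))))
compositions-complete (suc (suc n)) {suc (suc x) ∷ xs} (isComposition (_ ∷ pos) tot) =
  ∈-++⁺ʳ (map (1 ∷_) (compositions (suc n))) (∈-map⁺ bump
    (compositions-complete (suc n)
      (isComposition (s≤s z≤n ∷ pos) (suc-injective tot))))

bump-injective : ∀ {xs ys} → bump xs ≡ bump ys → xs ≡ ys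
bump-injective {[]}    {[]}    _    = refl
bump-injective {_ ∷ _} {_ ∷ _} refl = refl

compositions-unique : ∀ n → Unique (compositions n)
compositions-unique 0 = [] ∷ []
compositions-unique 1 = [] ∷ []
compositions-unique (suc (suc n)) =
  Unique.++⁺ (Unique.map⁺ ∷-injectiveʳ (compositions-unique (suc n)))
             (Unique.map⁺ bump-injective (compositions-unique (suc n)))
             disjoint
  where
  disjoint : ∀ {xs} → xs ∈ map (1 ∷_) (compositions (suc n)) ×
                      xs ∈ map bump (compositions (suc n)) → ⊥
  disjoint (xs∈ˡ , xs∈ʳ)
    with ∈-map⁻ (1 ∷_) xs∈ˡ | ∈-map⁻ bump xs∈ʳ
  ... | _ , _ , refl | zero ∷ _ , ys∈ , refl
    with isComposition (() ∷ _) _ ← All.lookup (compositions-sound (suc n)) ys∈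

partitions-sound : ∀ n {xs} → xs ∈ partitions n → IsPartition n xs
partitions-sound n xs∈
  with xs∈c , dec ← ∈-filter⁻ (linked? _≥?_) {xs = compositions n} xs∈
  with isComposition pos tot ← All.lookup (compositions-sound n) xs∈c
  = isPartition pos dec tot

partitions-complete : ∀ n {xs} → IsPartition n xs → xs ∈ partitions n
partitions-complete n (isPartition pos dec tot) =
  ∈-filter⁺ (linked? _≥?_) (compositions-complete n (isComposition pos tot)) dec

partitions-unique : ∀ n → Unique (partitions n)
partitions-unique n = Unique.filter⁺ (linked? _≥?_) (compositions-unique n)

{-# OPTIONS --safe #-}

-- Write a k n for the number of partitions of n whose smallest part occurs at
-- least k times.  For k ≥ 1,
--   a k (n + k) + a (k + 1) n ≡ p n + a k n.
-- Indeed, lower k copies of the smallest part s of a partition counted by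
-- a k (n + k) by one each.  If s = 1 those copies vanish and an arbitrary
-- partition of n remains; if s > 1 the result is a partition of n whose smallest
-- part occurs exactly k times.  Since a 1 agrees with p on positive arguments,
-- the instances k = 1 (at n and n + 2) and k = 2 (at n) give the theorem.
module Submission where

open import Defs
open import Data.Nat.Base as ℕ using (ℕ)
open import Data.Integer.Base using (+_; _+_; _-_; _*_)
open import Relation.Binary.PropositionalEquality using (_≡_)

open import Data.List.Base using (List; []; _∷_; _++_; map; filter; length; replicate; reverse)
open import Data.List.Extrema.Nat using (min; min≤⊤; min≤xs; argmin-sel)
open import Data.List.Membership.Propositional using (_∈_; lose; find)
open import Data.List.Membership.Propositional.Properties
  using (∈-map⁺; ∈-map⁻; ∈-++⁺ˡ; ∈-++⁺ʳ; ∈-++⁻; ∈-filter⁺; ∈-filter⁻)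
open import Data.List.Membership.Propositional.Properties.WithK using (unique∧set⇒bag)
open import Data.List.Properties
  using (++-assoc; ++-cancelʳ; ++-identityʳ; ∷-injective; filter-++; filter-all;
         filter-none; filter-reject; filter-some; length-++; length-map; length-replicate; length-reverse;
         reverse-++; reverse-injective; reverse-involutive)
open import Data.List.Relation.Binary.BagAndSetEquality using (_∼[_]_; set; ∼bag⇒↭)
open import Data.List.Relation.Binary.Permutation.Propositional.Properties
  using (↭-length; ↭-reverse; All-resp-↭)
open import Data.List.Relation.Binary.Permutation.Propositional using (↭-sym)
open import Data.List.Relation.Unary.All as All using (All; []; _∷_)
import Data.List.Relation.Unary.All.Properties as All
open import Data.List.Relation.Unary.AllPairs using (AllPairs; []; _∷_)
import Data.List.Relation.Unary.AllPairs.Properties as AllPairs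
open import Data.List.Relation.Unary.Any using (here; there)
open import Data.List.Relation.Unary.Linked as Linked using (Linked; []; [-]; _∷_)
open import Data.List.Relation.Unary.Linked.Properties
  using (AllPairs⇒Linked; Linked⇒AllPairs; Linked⇒All)
open import Data.List.Relation.Unary.Unique.Propositional using (Unique)
import Data.List.Relation.Unary.Unique.Propositional.Properties as Unique
open import Data.Nat.Base using (zero; suc; _≤_; _≥_; _<_; s≤s; z≤n)
open import Data.Nat.ListAction using (sum)
open import Data.Nat.ListAction.Properties using (sum-++)
import Data.Nat.Properties as ℕ
import Data.Nat.Solver as ℕ
import Data.Integer.Properties as ℤ
import Data.Integer.Solver as ℤ
open import Data.Product.Base using (_×_; _,_; ∃; ∃₂)
open import Data.Sum.Base using (inj₁; inj₂)
open import Function.Base using (_∘_; flip)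
open import Function.Bundles using (mk⇔)
open import Level using (Level)
open import Relation.Binary.PropositionalEquality
  using (refl; sym; trans; cong; cong₂; subst; module ≡-Reasoning)
open import Relation.Nullary using (¬_; yes; no; contradiction)
open import Relation.Nullary.Decidable using (_×-dec_; ¬?)
open import Relation.Unary using (Pred; Decidable; _⊆_)

private
  variable
    ℓ₁ ℓ₂ ℓ₃ : Level
    A : Set ℓ₁
    k n s : ℕ
    xs ys zs : List ℕ

-- Lists

-- Such lists are equal as bags, hence permutations of each other. Counts can thus be compared by
-- membership implications in both directions, without an explicit inverse map.
unique∧set⇒length : {xs ys : List A} →
  Unique xs → Unique ys → xs ∼[ set ] ys → length xs ≡ length ys
unique∧set⇒length u v eq = ↭-length (∼bag⇒↭ (unique∧set⇒bag u v eq))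

-- Meant for `P` demanding one more copy of the smallest part than `Q`, so that the last filter
-- selects an exact multiplicity.
length-filter-∖ : {P : Pred A ℓ₂} {Q : Pred A ℓ₃} (P? : Decidable P) (Q? : Decidable Q) →
  P ⊆ Q → ∀ xs →
  length (filter Q? xs) ≡
    length (filter P? xs) ℕ.+ length (filter (λ x → Q? x ×-dec ¬? (P? x)) xs)
length-filter-∖ P? Q? P⊆Q [] = refl
length-filter-∖ P? Q? P⊆Q (x ∷ xs) with P? x | Q? x
... | yes _ | yes _ = cong suc (length-filter-∖ P? Q? P⊆Q xs)
... | yes p | no ¬q = contradiction (P⊆Q p) ¬q
... | no _  | yes _ = trans (cong suc (length-filter-∖ P? Q? P⊆Q xs)) (sym (ℕ.+-suc _ _))
... | no _  | no _  = length-filter-∖ P? Q? P⊆Q xs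

replicate-+ : ∀ m n (x : A) → replicate (m ℕ.+ n) x ≡ replicate m x ++ replicate n x
replicate-+ zero    n x = refl
replicate-+ (suc m) n x = cong (x ∷_) (replicate-+ m n x)

all-≡⇒replicate : {x : A} {xs : List A} → All (x ≡_) xs → xs ≡ replicate (length xs) x
all-≡⇒replicate []          = refl
all-≡⇒replicate (refl ∷ eqs) = cong (_ ∷_) (all-≡⇒replicate eqs)

reverse-replicate : ∀ n (x : A) → reverse (replicate n x) ≡ replicate n x
reverse-replicate n x = begin
  reverse (replicate n x)
    ≡⟨ all-≡⇒replicate (All-resp-↭ (↭-sym (↭-reverse (replicate n x))) (All.replicate⁺ n refl)) ⟩
  replicate (length (reverse (replicate n x))) x
    ≡⟨ cong (λ m → replicate m x) (trans (length-reverse (replicate n x)) (length-replicate n)) ⟩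
  replicate n x ∎
  where open ≡-Reasoning

sum-replicate : ∀ n s → sum (replicate n s) ≡ n ℕ.* s
sum-replicate zero    s = refl
sum-replicate (suc n) s = cong (s ℕ.+_) (sum-replicate n s)

raisePrefix : ℕ → List ℕ → List ℕ
raisePrefix zero    xs       = xs
raisePrefix (suc k) []       = []
raisePrefix (suc k) (x ∷ xs) = suc x ∷ raisePrefix k xs

raisePrefix-injective : ∀ k {xs ys} → raisePrefix k xs ≡ raisePrefix k ys → xs ≡ ys
raisePrefix-injective zero eq = eq
raisePrefix-injective (suc k) {[]}    {[]}    _  = refl
raisePrefix-injective (suc k) {x ∷ xs} {y ∷ ys} eq with ∷-injective eq
... | eq₁ , eq₂ = cong₂ _∷_ (ℕ.suc-injective eq₁) (raisePrefix-injective k eq₂)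

raisePrefix-replicate : ∀ k s xs →
  raisePrefix k (replicate k s ++ xs) ≡ replicate k (suc s) ++ xs
raisePrefix-replicate zero    s xs = refl
raisePrefix-replicate (suc k) s xs = cong (suc s ∷_) (raisePrefix-replicate k s xs)

-- Reverses the lowering of the smallest copies, which sit at the end of a decreasing list. Raising
-- is injective on all lists, whereas truncated lowering would identify 0 and 1.
raiseSuffix : ℕ → List ℕ → List ℕ
raiseSuffix k xs = reverse (raisePrefix k (reverse xs))

raiseSuffix-injective : ∀ k {xs ys} → raiseSuffix k xs ≡ raiseSuffix k ys → xs ≡ ys
raiseSuffix-injective k = reverse-injective ∘ raisePrefix-injective k ∘ reverse-injective

reverse-++-replicate : ∀ (xs : List A) n x →
  reverse (xs ++ replicate n x) ≡ replicate n x ++ reverse xs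
reverse-++-replicate xs n x =
  trans (reverse-++ xs (replicate n x)) (cong (_++ reverse xs) (reverse-replicate n x))

raiseSuffix-replicate : ∀ k s xs →
  raiseSuffix k (xs ++ replicate k s) ≡ xs ++ replicate k (suc s)
raiseSuffix-replicate k s xs = begin
  reverse (raisePrefix k (reverse (xs ++ replicate k s)))
    ≡⟨ cong (reverse ∘ raisePrefix k) (reverse-++-replicate xs k s) ⟩
  reverse (raisePrefix k (replicate k s ++ reverse xs))
    ≡⟨ cong reverse (raisePrefix-replicate k s (reverse xs)) ⟩
  reverse (replicate k (suc s) ++ reverse xs)
    ≡⟨ cong reverse (reverse-++-replicate xs k (suc s)) ⟨
  reverse (reverse (xs ++ replicate k (suc s)))
    ≡⟨ reverse-involutive _ ⟩
  xs ++ replicate k (suc s) ∎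
  where open ≡-Reasoning

-- Decreasing lists

≥-trans : ∀ {i j k} → i ≥ j → j ≥ k → i ≥ k
≥-trans = flip ℕ.≤-trans

linked-++⁻ˡ : ∀ xs → Linked _≥_ (xs ++ ys) → Linked _≥_ xs
linked-++⁻ˡ []           _         = []
linked-++⁻ˡ (_ ∷ [])     _         = [-]
linked-++⁻ˡ (_ ∷ y ∷ xs) (r ∷ rs) = r ∷ linked-++⁻ˡ (y ∷ xs) rs

allPairs-replicate : ∀ n s → AllPairs _≥_ (replicate n s)
allPairs-replicate zero    s = []
allPairs-replicate (suc n) s = All.replicate⁺ n ℕ.≤-refl ∷ allPairs-replicate n s

linked-++-replicate⁺ : ∀ k → Linked _≥_ xs → All (s ≤_) xs → Linked _≥_ (xs ++ replicate k s)
linked-++-replicate⁺ {s = s} k dec s≤xs = AllPairs⇒Linked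
  (AllPairs.++⁺ (Linked⇒AllPairs ≥-trans dec) (allPairs-replicate k s)
    (All.map (All.replicate⁺ k) s≤xs))

-- From the first part equal to `s` onwards, the ordering bounds every part above by `s` and the
-- hypothesis bounds it below, so only copies of `s` remain.
splitSmallest : Linked _≥_ xs → All (s ≤_) xs →
  ∃ λ zs → All (s <_) zs × xs ≡ zs ++ replicate (multiplicity s xs) s
splitSmallest [] [] = [] , [] , refl
splitSmallest {xs = x ∷ xs} {s = s} dec s≤@(s≤x ∷ _) with s ℕ.≟ x
... | yes refl = [] , [] , (begin
    x ∷ xs
      ≡⟨ all-≡⇒replicate all-x ⟩
    replicate (length (x ∷ xs)) x
      ≡⟨ cong (λ ys → replicate (length ys) x) (filter-all (x ℕ.≟_) all-x) ⟨
    replicate (multiplicity x (x ∷ xs)) x ∎)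
  where
  open ≡-Reasoning
  all-x : All (x ≡_) (x ∷ xs)
  all-x = All.zipWith (λ (x≤y , y≤x) → ℕ.≤-antisym x≤y y≤x) (s≤ , Linked⇒All ≥-trans ℕ.≤-refl dec)
splitSmallest {xs = x ∷ xs} {s = s} dec (s≤x ∷ s≤xs) | no s≢x
  with zs , s<zs , eq ← splitSmallest (Linked.tail dec) s≤xs
  = x ∷ zs , ℕ.≤∧≢⇒< s≤x s≢x ∷ s<zs ,
    cong (x ∷_) (trans eq (cong (λ ys → zs ++ replicate (length ys) s)
      (sym (filter-reject (s ℕ.≟_) s≢x))))

-- Multiplicities

multiplicity-++-replicate : ∀ xs k s →
  multiplicity s (xs ++ replicate k s) ≡ multiplicity s xs ℕ.+ k
multiplicity-++-replicate xs k s = begin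
  length (filter (s ℕ.≟_) (xs ++ replicate k s))
    ≡⟨ cong length (filter-++ (s ℕ.≟_) xs (replicate k s)) ⟩
  length (filter (s ℕ.≟_) xs ++ filter (s ℕ.≟_) (replicate k s))
    ≡⟨ length-++ (filter (s ℕ.≟_) xs) ⟩
  multiplicity s xs ℕ.+ length (filter (s ℕ.≟_) (replicate k s))
    ≡⟨ cong (λ ys → multiplicity s xs ℕ.+ length ys)
            (filter-all (s ℕ.≟_) (All.replicate⁺ k refl)) ⟩
  multiplicity s xs ℕ.+ length (replicate k s)
    ≡⟨ cong (multiplicity s xs ℕ.+_) (length-replicate k) ⟩
  multiplicity s xs ℕ.+ k ∎
  where open ≡-Reasoning

multiplicity-below : All (s <_) xs → multiplicity s xs ≡ 0
multiplicity-below s<xs = cong length (filter-none _ (All.map ℕ.<⇒≢ s<xs))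

smallestOccursAtLeast-pred : SmallestOccursAtLeast (suc k) xs → SmallestOccursAtLeast k xs
smallestOccursAtLeast-pred soal with _ , s∈ , s≤ , k< ← find soal = lose s∈ (s≤ , ℕ.<⇒≤ k<)

-- The minimum is the witness. The head serves as the default value of `min`, so the result is
-- always a member of the list.
smallestOccursAtLeast-one : 0 < length xs → SmallestOccursAtLeast 1 xs
smallestOccursAtLeast-one {xs = x ∷ xs} _ =
  lose min∈ (min≤⊤ x xs ∷ min≤xs x xs , filter-some (min x xs ℕ.≟_) min∈)
  where
  min∈ : min x xs ∈ x ∷ xs
  -- `min` is `argmin` at the identity.
  min∈ with argmin-sel (λ y → y) x xs
  ... | inj₁ eq = here eq
  ... | inj₂ m∈ = there m∈

smallestOccursAtLeast-++-replicate : ∀ k → All (s ≤_) xs →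
  SmallestOccursAtLeast (suc k) (xs ++ replicate (suc k) s)
smallestOccursAtLeast-++-replicate {s = s} {xs = xs} k s≤xs =
  lose (∈-++⁺ʳ xs (here refl))
    ( All.++⁺ s≤xs (All.replicate⁺ (suc k) ℕ.≤-refl)
    , subst (suc k ≤_) (sym (multiplicity-++-replicate xs (suc k) s)) (ℕ.m≤n+m (suc k) _) )

-- A witness `t` is at most `s`, which occurs in the list, and `s` is at most every entry, so `t` is
-- `s`. Its only copies are the `suc k` appended ones.
¬smallestOccursAtLeast-++-replicate : ∀ k → All (s <_) xs →
  ¬ SmallestOccursAtLeast (suc (suc k)) (xs ++ replicate (suc k) s)
¬smallestOccursAtLeast-++-replicate {s = s} {xs = xs} k s<xs soal
  with t , t∈ , t≤ , k< ← find soal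
  with refl ← ℕ.≤-antisym (All.lookup t≤ (∈-++⁺ʳ xs (here refl)))
                (All.lookup (All.++⁺ (All.map ℕ.<⇒≤ s<xs) (All.replicate⁺ (suc k) ℕ.≤-refl)) t∈)
  = ℕ.<-irrefl (sym (trans (multiplicity-++-replicate xs (suc k) s)
                           (cong (ℕ._+ suc k) (multiplicity-below s<xs)))) k<

-- Partitions

isPartition-cast : ∀ {m n} → m ≡ n → IsPartition m xs → IsPartition n xs
isPartition-cast refl part = part

isPartition-++-replicate⁺ : ∀ k → 0 < s → All (s ≤_) xs → IsPartition n xs →
  IsPartition (n ℕ.+ k ℕ.* s) (xs ++ replicate k s)
isPartition-++-replicate⁺ {s = s} {xs = xs} k 0<s s≤xs (isPartition pos dec refl) = isPartition
  (All.++⁺ pos (All.replicate⁺ k 0<s))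
  (linked-++-replicate⁺ k dec s≤xs)
  (trans (sum-++ xs (replicate k s)) (cong (sum xs ℕ.+_) (sum-replicate k s)))

isPartition-++-replicate⁻ : ∀ xs k s → IsPartition n (xs ++ replicate k s) →
  ∃ λ m → IsPartition m xs × n ≡ m ℕ.+ k ℕ.* s
isPartition-++-replicate⁻ xs k s (isPartition pos dec refl) =
  sum xs , isPartition (All.++⁻ˡ xs pos) (linked-++⁻ˡ xs dec) refl ,
  trans (sum-++ xs (replicate k s)) (cong (sum xs ℕ.+_) (sum-replicate k s))

-- A view that keeps the `k` copies to be lowered apart from the `j` surplus copies of the same
-- part.
data SmallestSplit (k : ℕ) : List ℕ → Set where
  smallestSplit : ∀ zs j s → All (s <_) zs →
    SmallestSplit k ((zs ++ replicate j s) ++ replicate k s)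

smallestSplit⁺ : IsPartition n xs → SmallestOccursAtLeast k xs → SmallestSplit k xs
smallestSplit⁺ {xs = xs} {k = k} (isPartition _ dec _) soal
  with s , _ , s≤ , k≤ ← find soal
  with zs , s<zs , eq ← splitSmallest dec s≤
  = subst (SmallestSplit k) (sym eq′) (smallestSplit zs j s s<zs)
  where
  open ≡-Reasoning
  j = multiplicity s xs ℕ.∸ k
  eq′ : xs ≡ (zs ++ replicate j s) ++ replicate k s
  eq′ = begin
    xs                                      ≡⟨ eq ⟩
    zs ++ replicate (multiplicity s xs) s   ≡⟨ cong (λ m → zs ++ replicate m s) (ℕ.m∸n+n≡m k≤) ⟨
    zs ++ replicate (j ℕ.+ k) s             ≡⟨ cong (zs ++_) (replicate-+ j k s) ⟩
    zs ++ (replicate j s ++ replicate k s)  ≡⟨ ++-assoc zs _ _ ⟨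
    (zs ++ replicate j s) ++ replicate k s  ∎

-- Counting partitions by the multiplicity of the smallest part

a : ℕ → ℕ → ℕ
a k n = length (filter (smallestOccursAtLeast? k) (partitions n))

-- A partition of a positive number is nonempty and so has a smallest part. At 0 the values differ:
-- the empty partition is counted by `p` only.
a-one : ∀ n → 0 < n → a 1 n ≡ p n
a-one n 0<n = cong length (filter-all (smallestOccursAtLeast? 1)
  (All.tabulate (λ xs∈ → smallestOccursAtLeast-one (nonempty (partitions-sound n xs∈)))))
  where
  nonempty : IsPartition n xs → 0 < length xs
  nonempty {xs = []}    (isPartition _ _ refl) = 0<n
  nonempty {xs = _ ∷ _} _                      = s≤s z≤n

-- The recurrence, for fixed multiplicity and size

module _ (k n : ℕ) where

  private
    K = suc k

    exactly? : Decidable (λ xs → SmallestOccursAtLeast K xs × ¬ SmallestOccursAtLeast (suc K) xs)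
    exactly? xs = smallestOccursAtLeast? K xs ×-dec ¬? (smallestOccursAtLeast? (suc K) xs)

    -- `fromOne` restores `K` vanished ones and `fromLarger` undoes the lowering of a larger
    -- smallest part. Together they list the members of `source`, each once.
    source fromOne fromLarger : List (List ℕ)
    source     = filter (smallestOccursAtLeast? K) (partitions (n ℕ.+ K))
    fromOne    = map (_++ replicate K 1) (partitions n)
    fromLarger = map (raiseSuffix K) (filter exactly? (partitions n))

    -- The parts in `zs` exceed `s`, so they still bound the raised copies from above; each of the
    -- `K` copies adds one to the total.
    isPartition-raise : ∀ s → All (s <_) zs → IsPartition n (zs ++ replicate K s) →
      IsPartition (n ℕ.+ K) (zs ++ replicate K (suc s))
    isPartition-raise {zs = zs} s s<zs part
      with m , part′ , refl ← isPartition-++-replicate⁻ zs K s part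
      = isPartition-cast
          (solve 3 (λ m K s → m :+ K :* (con 1 :+ s) := m :+ K :* s :+ K) refl m K s)
          (isPartition-++-replicate⁺ K (s≤s z≤n) s<zs part′)
      where open ℕ.+-*-Solver

    isPartition-lower : ∀ s → 0 < s → All (s <_) zs →
      IsPartition (n ℕ.+ K) (zs ++ replicate K (suc s)) → IsPartition n (zs ++ replicate K s)
    isPartition-lower {zs = zs} s 0<s s<zs part
      with m , part′ , eq ← isPartition-++-replicate⁻ zs K (suc s) part
      = isPartition-cast
          (ℕ.+-cancelʳ-≡ K _ _ (sym (trans eq
            (solve 3 (λ m K s → m :+ K :* (con 1 :+ s) := m :+ K :* s :+ K) refl m K s))))
          (isPartition-++-replicate⁺ K 0<s (All.map ℕ.<⇒≤ s<zs) part′)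
      where open ℕ.+-*-Solver

    -- The preimage is the list with the block lowered to `s`. Since `zs` stays strictly above `s`,
    -- the smallest part there occurs exactly `K` times.
    ∈-fromLarger⁺ : ∀ s → 0 < s → All (s <_) zs →
      IsPartition (n ℕ.+ K) (zs ++ replicate K (suc s)) → zs ++ replicate K (suc s) ∈ fromLarger
    ∈-fromLarger⁺ {zs = zs} s 0<s s<zs part =
      subst (_∈ fromLarger) (raiseSuffix-replicate K s zs)
        (∈-map⁺ (raiseSuffix K) (∈-filter⁺ exactly?
          (partitions-complete n (isPartition-lower s 0<s s<zs part))
          ( smallestOccursAtLeast-++-replicate k (All.map ℕ.<⇒≤ s<zs)
          , ¬smallestOccursAtLeast-++-replicate k s<zs )))

    source⇒ : xs ∈ source → xs ∈ fromOne ++ fromLarger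
    source⇒ xs∈
      with xs∈p , soal ← ∈-filter⁻ (smallestOccursAtLeast? K) {xs = partitions (n ℕ.+ K)} xs∈
      with part ← partitions-sound (n ℕ.+ K) xs∈p
      with smallestSplit⁺ part soal
    ... | smallestSplit zs j zero _ =
      contradiction (All.head (All.++⁻ʳ (zs ++ replicate j 0) (IsPartition.positive part))) λ ()
    ... | smallestSplit zs j 1 _
      with m , part′ , eq ← isPartition-++-replicate⁻ (zs ++ replicate j 1) K 1 part
      = ∈-++⁺ˡ (∈-map⁺ (_++ replicate K 1) (partitions-complete n
          (isPartition-cast
            (sym (ℕ.+-cancelʳ-≡ K n m (trans eq (cong (m ℕ.+_) (ℕ.*-identityʳ K))))) part′)))
    -- The block drops to `suc t`, while the `j` surplus copies of `suc (suc t)` join the larger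
    -- parts.
    ... | smallestSplit zs j (suc (suc t)) s<zs =
      ∈-++⁺ʳ fromOne (∈-fromLarger⁺ (suc t) (s≤s z≤n)
        (All.++⁺ (All.map ℕ.<⇒≤ s<zs) (All.replicate⁺ j ℕ.≤-refl)) part)

    fromOne⇒ : xs ∈ fromOne → xs ∈ source
    fromOne⇒ xs∈
      with ys , ys∈ , refl ← ∈-map⁻ (_++ replicate K 1) xs∈
      with part ← partitions-sound n ys∈
      = ∈-filter⁺ (smallestOccursAtLeast? K)
          (partitions-complete (n ℕ.+ K)
            (isPartition-cast (cong (n ℕ.+_) (ℕ.*-identityʳ K))
              -- Positivity `0 < x` unfolds to `1 ≤ x`, so it also says that the appended ones are
              -- smallest.
              (isPartition-++-replicate⁺ K (s≤s z≤n) (IsPartition.positive part) part)))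
          (smallestOccursAtLeast-++-replicate k (IsPartition.positive part))

    fromLarger-shape : xs ∈ fromLarger → ∃₂ λ zs s →
      All (s <_) zs × 0 < s × IsPartition n (zs ++ replicate K s) × xs ≡ zs ++ replicate K (suc s)
    fromLarger-shape xs∈
      with ys , ys∈ , refl ← ∈-map⁻ (raiseSuffix K) xs∈
      with ys∈p , soal , ¬soal ← ∈-filter⁻ exactly? {xs = partitions n} ys∈
      with part ← partitions-sound n ys∈p
      with smallestSplit⁺ part soal
    ... | smallestSplit zs zero s s<zs rewrite ++-identityʳ zs =
      zs , s , s<zs , All.head (All.++⁻ʳ zs (IsPartition.positive part)) , part ,
      raiseSuffix-replicate K s zs
    -- A surplus copy would make `s` occur at least `suc K` times, so exactness forces the surplus
    -- to be zero.
    ... | smallestSplit zs (suc j) s s<zs = contradiction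
      (lose (∈-++⁺ʳ front (here refl))
        ( All.++⁺ s≤front (All.replicate⁺ K ℕ.≤-refl)
        , subst (suc K ≤_) (sym (trans (multiplicity-++-replicate front K s)
            (cong (ℕ._+ K) (multiplicity-++-replicate zs (suc j) s))))
            (ℕ.+-monoˡ-≤ K (ℕ.≤-trans (s≤s z≤n) (ℕ.m≤n+m (suc j) _))) ))
      ¬soal
      where
      front = zs ++ replicate (suc j) s
      s≤front = All.++⁺ (All.map ℕ.<⇒≤ s<zs) (All.replicate⁺ (suc j) ℕ.≤-refl)

    fromLarger⇒ : xs ∈ fromLarger → xs ∈ source
    fromLarger⇒ xs∈ with zs , s , s<zs , 0<s , part , refl ← fromLarger-shape xs∈ =
      ∈-filter⁺ (smallestOccursAtLeast? K)
        (partitions-complete (n ℕ.+ K) (isPartition-raise s s<zs part))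
        (smallestOccursAtLeast-++-replicate k s<zs)

    -- The raised copies are the smallest parts and come from a positive `s`. This separates
    -- `fromLarger` from `fromOne`, whose members contain a 1.
    1<fromLarger : xs ∈ fromLarger → All (1 <_) xs
    1<fromLarger xs∈ with zs , s , s<zs , 0<s , part , refl ← fromLarger-shape xs∈ =
      All.++⁺ (All.map (ℕ.≤-<-trans 0<s) s<zs) (All.replicate⁺ K (s≤s 0<s))

    disjoint : ¬ (xs ∈ fromOne × xs ∈ fromLarger)
    disjoint (xs∈ˡ , xs∈ʳ) with ys , _ , refl ← ∈-map⁻ (_++ replicate K 1) xs∈ˡ =
      ℕ.<-irrefl refl (All.head (All.++⁻ʳ ys (1<fromLarger xs∈ʳ)))

    ⇒source : xs ∈ fromOne ++ fromLarger → xs ∈ source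
    ⇒source xs∈ with ∈-++⁻ fromOne xs∈
    ... | inj₁ xs∈ˡ = fromOne⇒ xs∈ˡ
    ... | inj₂ xs∈ʳ = fromLarger⇒ xs∈ʳ

    length-source : length source ≡ p n ℕ.+ length (filter exactly? (partitions n))
    length-source = begin
      length source
        ≡⟨ unique∧set⇒length
             (Unique.filter⁺ (smallestOccursAtLeast? K) (partitions-unique (n ℕ.+ K)))
             (Unique.++⁺
               (Unique.map⁺ (++-cancelʳ (replicate K 1) _ _) (partitions-unique n))
               (Unique.map⁺ (raiseSuffix-injective K)
                 (Unique.filter⁺ exactly? (partitions-unique n)))
               disjoint)
             (mk⇔ source⇒ ⇒source) ⟩
      length (fromOne ++ fromLarger)
        ≡⟨ length-++ fromOne ⟩
      length fromOne ℕ.+ length fromLarger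
        ≡⟨ cong₂ ℕ._+_ (length-map _ (partitions n))
             (length-map _ (filter exactly? (partitions n))) ⟩
      p n ℕ.+ length (filter exactly? (partitions n)) ∎
      where open ≡-Reasoning

  -- `length-source` leaves the partitions of `n` with multiplicity exactly `K`; adding those with
  -- at least `suc K` completes them to `a K n`, with no subtraction in ℕ.
  a-recurrence : a K (n ℕ.+ K) ℕ.+ a (suc K) n ≡ p n ℕ.+ a K n
  a-recurrence = begin
    a K (n ℕ.+ K) ℕ.+ a (suc K) n
      ≡⟨ cong (ℕ._+ a (suc K) n) length-source ⟩
    p n ℕ.+ exact ℕ.+ a (suc K) n
      ≡⟨ ℕ.+-assoc (p n) exact (a (suc K) n) ⟩
    p n ℕ.+ (exact ℕ.+ a (suc K) n)
      ≡⟨ cong (p n ℕ.+_) (ℕ.+-comm exact (a (suc K) n)) ⟩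
    p n ℕ.+ (a (suc K) n ℕ.+ exact)
      ≡⟨ cong (p n ℕ.+_) (length-filter-∖ (smallestOccursAtLeast? (suc K))
           (smallestOccursAtLeast? K) smallestOccursAtLeast-pred (partitions n)) ⟨
    p n ℕ.+ a K n ∎
    where
    open ≡-Reasoning
    exact = length (filter exactly? (partitions n))

-- Solving the recurrences for the third count

a-two : ∀ n → 0 < n → p (n ℕ.+ 1) ℕ.+ a 2 n ≡ p n ℕ.+ p n
a-two n 0<n = begin
  p (n ℕ.+ 1) ℕ.+ a 2 n    ≡⟨ cong (ℕ._+ a 2 n) (a-one (n ℕ.+ 1) (ℕ.m≤n⇒m≤n+o 1 0<n)) ⟨
  -- The argument 0 stands for multiplicity `K = 1`.
  a 1 (n ℕ.+ 1) ℕ.+ a 2 n  ≡⟨ a-recurrence 0 n ⟩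
  p n ℕ.+ a 1 n            ≡⟨ cong (p n ℕ.+_) (a-one n 0<n) ⟩
  p n ℕ.+ p n              ∎
  where open ≡-Reasoning

eliminate : ∀ p₀ p₁ p₂ p₃ x y z →
  p₁ ℕ.+ x ≡ p₀ ℕ.+ p₀ → p₃ ℕ.+ y ≡ p₂ ℕ.+ p₂ → y ℕ.+ z ≡ p₀ ℕ.+ x →
  + z ≡ + 3 * + p₀ - + p₁ - + 2 * + p₂ + + p₃
eliminate p₀ p₁ p₂ p₃ x y z e₁ e₂ e₃ = begin
  + z
    ≡⟨ solve 2 (λ Y Z → Z := (Y :+ Z) :- Y) refl (+ y) (+ z) ⟩
  (+ y + + z) - + y
    -- `+ y + + z` computes to `+ (y ℕ.+ z)`, so equations in ℕ transfer by `cong +_`.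
    ≡⟨ cong (_- + y) (cong +_ e₃) ⟩
  (+ p₀ + + x) - + y
    -- Adding and subtracting `p₁` and `p₃` exposes the left sides of `e₁` and `e₂`.
    ≡⟨ solve 5 (λ P₀ P₁ P₃ X Y →
         (P₀ :+ X) :- Y := P₀ :+ (P₁ :+ X) :- P₁ :- (P₃ :+ Y) :+ P₃)
         refl (+ p₀) (+ p₁) (+ p₃) (+ x) (+ y) ⟩
  + p₀ + (+ p₁ + + x) - + p₁ - (+ p₃ + + y) + + p₃
    ≡⟨ cong₂ (λ u v → + p₀ + u - + p₁ - v + + p₃) (cong +_ e₁) (cong +_ e₂) ⟩
  + p₀ + (+ p₀ + + p₀) - + p₁ - (+ p₂ + + p₂) + + p₃
    ≡⟨ solve 4 (λ P₀ P₁ P₂ P₃ →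
         P₀ :+ (P₀ :+ P₀) :- P₁ :- (P₂ :+ P₂) :+ P₃ :=
         con (+ 3) :* P₀ :- P₁ :- con (+ 2) :* P₂ :+ P₃)
         refl (+ p₀) (+ p₁) (+ p₂) (+ p₃) ⟩
  + 3 * + p₀ - + p₁ - + 2 * + p₂ + + p₃ ∎
  where
  open ≡-Reasoning
  open ℤ.+-*-Solver

theorem1p4 : (n : ℕ) → n ℕ.≥ 1 →
    + a₃ n ≡ + 3 * + p n - + p (n ℕ.+ 1) - + 2 * + p (n ℕ.+ 2) + + p (n ℕ.+ 3)
theorem1p4 n n≥1 = eliminate
  (p n) (p (n ℕ.+ 1)) (p (n ℕ.+ 2)) (p (n ℕ.+ 3)) (a 2 n) (a 2 (n ℕ.+ 2)) (a₃ n)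
  (a-two n n≥1)
  (subst (λ m → p m ℕ.+ a 2 (n ℕ.+ 2) ≡ p (n ℕ.+ 2) ℕ.+ p (n ℕ.+ 2)) (ℕ.+-assoc n 2 1)
    (a-two (n ℕ.+ 2) (ℕ.m≤n⇒m≤n+o 2 n≥1)))
  -- Here `K = 2`, and `a 3 n` is `a₃ n` by definition.
  (a-recurrence 1 n)
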